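{- Let $k \in \{1,2,3,4\}$ and let $T$ be a finite rooted tree (with at least one edge) in which all leaves have depth $k$. Then $\mu_g(T) \le 3$.
   Context: The depth of a vertex in a rooted tree is its distance from the root (the root has depth $0$); a leaf of a rooted tree is a vertex without children. Majority coloring game: given a graph $G$ and a palette of $k$ colors, two players Alice and Bob alternately (Alice first) choose an uncolored vertex of $G$ and assign it a color from the palette, so that after every move the majority condition holds: for every colored vertex $v$, at most $\deg(v)/2$ of the neighbors of $v$ have the same color as $v$. (Uncolored vertices impose no condition; $\deg(v)$ is the degree in the whole graph $G$.) Alice wins if all vertices get colored; Bob wins if at some point there is an uncolored vertex to which no color of the palette can be legally assigned. The majority game chromatic number $\mu_g(G)$ is the least $k$ such that Alice has a winning strategy with a palette of $k$ colors. -}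

module Defs where

open import Data.Fin.Base using (Fin)
import Data.Fin.Properties as Fin
open import Data.List.Base using (List; []; _∷_; length; filter; allFin)
open import Data.List.Relation.Unary.Unique.Propositional using (Unique)
open import Data.Maybe.Base using (Maybe; just; nothing)
import Data.Maybe.Properties as Maybe
open import Data.Nat.Base using (ℕ; zero; suc; _*_; _≤_)
open import Data.Product.Base using (∃; ∃₂; _×_)
open import Data.Vec.Functional using (updateAt)
open import Level using (0ℓ)
open import Relation.Binary.Core using (Rel)
open import Relation.Binary.Definitions using (Decidable; Symmetric)
open import Relation.Binary.PropositionalEquality using (_≡_; _≢_)
open import Relation.Nullary.Decidable using (_×-dec_)
open import Relation.Nullary.Negation using (¬_)

record Graph (n : ℕ) : Set₁ where
  field
    _~_    : Rel (Fin n) 0ℓ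
    _~?_   : Decidable _~_
    ~-sym  : Symmetric _~_
    ~-irr  : ∀ {v} → ¬ (v ~ v)

  deg : Fin n → ℕ
  deg v = length (filter (v ~?_) (allFin n))

  data Walk : Fin n → Fin n → ℕ → Set where
    stop : ∀ {v} → Walk v v zero
    step : ∀ {u v w ℓ} → u ~ v → Walk v w ℓ → Walk u w (suc ℓ)

  vertices : ∀ {u v ℓ} → Walk u v ℓ → List (Fin n)
  vertices (stop {v})     = v ∷ []
  vertices (step {u} _ p) = u ∷ vertices p

  -- A cycle is a path with at least two edges together with an edge joining
  -- its two ends.
  record Cycle : Set where
    field
      {first last} : Fin n
      {len}        : ℕ
      walk         : Walk first last len
      isPath       : Unique (vertices walk)
      long         : 2 ≤ len
      closing      : last ~ first

  Connected : Set
  Connected = ∀ u v → ∃ λ ℓ → Walk u v ℓ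

  Acyclic : Set
  Acyclic = ¬ Cycle

  IsDistance : Fin n → Fin n → ℕ → Set
  IsDistance u v d = Walk u v d × (∀ ℓ → Walk u v ℓ → d ≤ ℓ)

  HasEdge : Set
  HasEdge = ∃₂ λ u v → u ~ v

record RootedTree (n : ℕ) : Set₁ where
  field
    graph     : Graph n
    root      : Fin n
    connected : Graph.Connected graph
    acyclic   : Graph.Acyclic graph

  open Graph graph

  HasDepth : Fin n → ℕ → Set
  HasDepth v d = IsDistance root v d

  _IsChildOf_ : Fin n → Fin n → Set
  u IsChildOf v = v ~ u × ∃ λ d → HasDepth v d × HasDepth u (suc d)

  IsLeaf : Fin n → Set
  IsLeaf v = ∀ u → ¬ (u IsChildOf v)

  AllLeavesAtDepth : ℕ → Set
  AllLeavesAtDepth k = ∀ v → IsLeaf v → HasDepth v k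

data Player : Set where
  alice bob : Player

module MajorityGame {n : ℕ} (G : Graph n) (k : ℕ) where

  open Graph G

  Coloring : Set
  Coloring = Fin n → Maybe (Fin k)

  blank : Coloring
  blank _ = nothing

  _[_≔_] : Coloring → Fin n → Fin k → Coloring
  c [ v ≔ x ] = updateAt c v (λ _ → just x)

  neighborsColored : Coloring → Fin n → Fin k → ℕ
  neighborsColored c v x =
    length (filter (λ u → (v ~? u) ×-dec Maybe.≡-dec Fin._≟_ (c u) (just x)) (allFin n))

  -- "At most deg(v)/2", with the denominator cleared.
  Majority : Coloring → Set
  Majority c = ∀ v x → c v ≡ just x → 2 * neighborsColored c v x ≤ deg v

  Legal : Coloring → Fin n → Fin k → Set
  Legal c v x = c v ≡ nothing × Majority (c [ v ≔ x ])

  Complete : Coloring → Set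
  Complete c = ∀ v → c v ≢ nothing

  BobHasWon : Coloring → Set
  BobHasWon c = ∃ λ v → c v ≡ nothing × (∀ x → ¬ Legal c v x)

  -- Winning strategies for Alice from a position with the given player to
  -- move. The game is over as soon as BobHasWon, whoever is to move; this
  -- also keeps `reply` from holding vacuously when Bob has no legal move.
  data AliceWins : Player → Coloring → Set where
    done  : ∀ {p c} → Complete c → AliceWins p c
    move  : ∀ {c} → ¬ BobHasWon c →
            ∀ v x → Legal c v x → AliceWins bob (c [ v ≔ x ]) →
            AliceWins alice c
    reply : ∀ {c} → ¬ BobHasWon c →
            (∀ v x → Legal c v x → AliceWins alice (c [ v ≔ x ])) →
            AliceWins bob c

AliceHasWinningStrategy : ∀ {n} → Graph n → ℕ → Set
AliceHasWinningStrategy G k = AliceWins alice blank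
  where open MajorityGame G k

-- μ_g(G) = m, as a relation: that a least palette size exists is left to be proved.
IsMajorityGameChromaticNumber : ∀ {n} → Graph n → ℕ → Set
IsMajorityGameChromaticNumber G m =
  AliceHasWinningStrategy G m × (∀ j → AliceHasWinningStrategy G j → m ≤ j)

{-# OPTIONS --safe #-}

-- Let the height of a vertex of depth d be k ∸ d. Alice first colors the root,
-- and afterwards keeps the following invariant: after each of her moves, every
-- uncolored vertex of height 1 or 3 has only uncolored children. A move of Bob
-- breaks this for at most one vertex, the parent of the vertex he colors, and
-- she then colors that parent with a color different from those of its own
-- parent and of Bob's vertex; no neighbor has this color, so it is legal. If the
-- invariant is not broken she colors any vertex of height 1 or 3, and once none
-- is left, any vertex at all.
--
-- Leaves always have a free color, being adjacent to their parent only. A vertex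
-- v of height 2 can always be colored as well: of the two colors different from
-- that of its parent, one occurs on at most half of the neighbors of v; a child u
-- of v with that color tolerates v as a neighbor of the same color, because u has
-- degree at least 2 and a leaf is never colored like its parent.
module Submission where

open import Data.Empty using (⊥; ⊥-elim)
open import Data.Fin.Base using (Fin; zero; suc)
open import Data.Fin.Properties using (_≟_; any?; all?)
open import Data.List.Base using ([]; _∷_; _∷ʳ_; length; filter; allFin)
open import Data.List.Membership.Propositional using (lose)
open import Data.List.Membership.Propositional.Properties using (∈-allFin)
open import Data.List.Properties using (filter-none; filter-some)
open import Data.List.Relation.Unary.All as All using (All; []; _∷_)
import Data.List.Relation.Unary.All.Properties as All
open import Data.List.Relation.Unary.AllPairs using ([]; _∷_)
import Data.List.Relation.Unary.AllPairs.Properties as AllPairs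
open import Data.List.Relation.Unary.Unique.Propositional using (Unique)
import Data.List.Relation.Unary.Unique.Propositional.Properties as Unique
open import Data.Maybe.Base using (just; nothing)
import Data.Maybe.Properties as Maybe
open import Data.Nat.Base using (ℕ; zero; suc; _+_; _*_; _∸_; _⊔_; _≤_; _<_; z≤n; s≤s)
import Data.Nat.Properties as ℕ
open import Data.Product.Base using (∃; ∃₂; Σ; _×_; _,_; proj₁; proj₂)
open import Data.Sum.Base as Sum using (_⊎_; inj₁; inj₂)
open import Data.Unit.Base using (tt)
open import Data.Vec.Functional.Properties using (updateAt-updates; updateAt-minimal)
open import Function.Base using (_∘_; id; case_of_)
open import Level using (0ℓ)
open import Relation.Binary.Definitions using (tri<; tri≈; tri>)
open import Relation.Binary.PropositionalEquality using (_≡_; _≢_; refl; sym; trans; cong; subst)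
open import Relation.Nullary.Decidable using (Dec; yes; no; toWitness; map′; ¬?; _×-dec_; _⊎-dec_; _→-dec_)
open import Relation.Nullary.Negation using (¬_; contradiction)
open import Relation.Unary using (Pred; Decidable)
open import Defs

-- Least witnesses and bounds on finite domains.

least : {P : ℕ → Set} → Decidable P → ∀ N → P N →
        ∃ λ m → P m × (∀ j → P j → m ≤ j) × m ≤ N
least P? zero    p = zero , p , (λ _ _ → z≤n) , z≤n
least P? (suc N) p with P? zero
... | yes p₀ = zero , p₀ , (λ _ _ → z≤n) , z≤n
... | no ¬p₀ with least (P? ∘ suc) N p
...   | m , pm , min , m≤N = suc m , pm , min′ , s≤s m≤N
  where
  min′ : ∀ j → _ → suc m ≤ j
  min′ zero    p₀ = contradiction p₀ ¬p₀
  min′ (suc j) pj = s≤s (min j pj)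

bounded : ∀ {n} (f : Fin n → ℕ) → ∃ λ M → ∀ i → f i ≤ M
bounded {zero}  f = 0 , λ ()
bounded {suc n} f with bounded (f ∘ suc)
... | M , f≤M = f zero ⊔ M , λ where
  zero    → ℕ.m≤m⊔n _ M
  (suc i) → ℕ.≤-trans (f≤M i) (ℕ.m≤n⊔m (f zero) M)

-- Counting

module _ {A : Set} {P Q R : Pred A 0ℓ}
         (P? : Decidable P) (Q? : Decidable Q) (R? : Decidable R) where

  length-filter-∪ : (∀ {x} → P x → Q x ⊎ R x) → ∀ xs →
    length (filter P? xs) ≤ length (filter Q? xs) + length (filter R? xs)
  length-filter-∪ P⇒Q∪R []       = z≤n
  length-filter-∪ P⇒Q∪R (x ∷ xs) with ih ← length-filter-∪ P⇒Q∪R xs | P? x | Q? x | R? x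
  ... | yes p | no ¬q | no ¬r = contradiction (P⇒Q∪R p) Sum.[ ¬q , ¬r ]
  ... | yes _ | yes _ | no  _ = s≤s ih
  ... | yes _ | no  _ | yes _ = ℕ.≤-trans (s≤s ih) (ℕ.≤-reflexive (sym (ℕ.+-suc _ _)))
  ... | yes _ | yes _ | yes _ = s≤s (ℕ.≤-trans ih (ℕ.+-monoʳ-≤ _ (ℕ.n≤1+n _)))
  ... | no  _ | yes _ | yes _ = ℕ.m≤n⇒m≤1+n (ℕ.≤-trans ih (ℕ.+-monoʳ-≤ _ (ℕ.n≤1+n _)))
  ... | no  _ | yes _ | no  _ = ℕ.m≤n⇒m≤1+n ih
  ... | no  _ | no  _ | yes _ = ℕ.≤-trans ih (ℕ.+-monoʳ-≤ _ (ℕ.n≤1+n _))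
  ... | no  _ | no  _ | no  _ = ih

  length-filter-⊎ : (∀ {x} → P x → R x) → (∀ {x} → Q x → R x) →
    (∀ {x} → P x → ¬ Q x) → ∀ xs →
    length (filter P? xs) + length (filter Q? xs) ≤ length (filter R? xs)
  length-filter-⊎ P⇒R Q⇒R P∩Q=∅ []       = z≤n
  length-filter-⊎ P⇒R Q⇒R P∩Q=∅ (x ∷ xs)
    with ih ← length-filter-⊎ P⇒R Q⇒R P∩Q=∅ xs | P? x | Q? x | R? x
  ... | yes p | yes q | _     = contradiction q (P∩Q=∅ p)
  ... | yes p | no  _ | no ¬r = contradiction (P⇒R p) ¬r
  ... | no  _ | yes q | no ¬r = contradiction (Q⇒R q) ¬r
  ... | yes _ | no  _ | yes _ = s≤s ih
  ... | no  _ | yes _ | yes _ = ℕ.≤-trans (ℕ.≤-reflexive (ℕ.+-suc _ _)) (s≤s ih)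
  ... | no  _ | no  _ | yes _ = ℕ.m≤n⇒m≤1+n ih
  ... | no  _ | no  _ | no  _ = ih

module _ {n : ℕ} {P : Pred (Fin n) 0ℓ} (P? : Decidable P) where

  count : ℕ
  count = length (filter P? (allFin n))

  count-none : (∀ {v} → ¬ P v) → count ≡ 0
  count-none ¬P = cong length (filter-none P? (All.universal (λ _ → ¬P) (allFin n)))

  count-some : ∀ {v} → P v → 1 ≤ count
  count-some {v} p = filter-some P? (lose (∈-allFin v) p)

  count-unique : (∀ {u v} → P u → P v → u ≡ v) → count ≤ 1
  count-unique P! = go (All.all-filter P? (allFin n)) (Unique.filter⁺ P? (Unique.allFin⁺ n))
    where
    go : ∀ {vs} → All P vs → Unique vs → length vs ≤ 1
    go []            _                   = z≤n
    go (_ ∷ [])      _                   = s≤s z≤n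
    go (p ∷ q ∷ _)   ((u≢v ∷ _) ∷ _)     = contradiction (P! p q) u≢v

module _ {n : ℕ} {P Q : Pred (Fin n) 0ℓ} (P? : Decidable P) (Q? : Decidable Q) where

  count-⊆ : (∀ {u} → P u → Q u) → count P? ≤ count Q?
  count-⊆ P⇒Q = ℕ.≤-trans (length-filter-∪ P? Q? (λ _ → no id) (inj₁ ∘ P⇒Q) (allFin n))
    (ℕ.≤-reflexive (trans (cong (count Q? +_) (count-none {n} {λ _ → ⊥} (λ _ → no id) id)) (ℕ.+-identityʳ _)))

  count-insert : ∀ v → (∀ {u} → P u → Q u ⊎ u ≡ v) → count P? ≤ suc (count Q?)
  count-insert v P⇒Q∪v = ℕ.≤-trans (length-filter-∪ P? Q? (_≟ v) P⇒Q∪v (allFin n))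
    (ℕ.≤-trans (ℕ.+-monoʳ-≤ (count Q?) (count-unique (_≟ v) (λ p q → trans p (sym q))))
               (ℕ.≤-reflexive (ℕ.+-comm _ 1)))

  count-⊂ : ∀ {v} → (∀ {u} → P u → Q u) → Q v → ¬ P v → count P? < count Q?
  count-⊂ {v} P⇒Q q ¬p = ℕ.≤-trans (ℕ.+-monoˡ-≤ (count P?) (count-some (_≟ v) refl))
    (length-filter-⊎ (_≟ v) P? Q? (λ { refl → q }) P⇒Q (λ { refl → ¬p }) (allFin n))

count-two : ∀ {n} {P : Pred (Fin n) 0ℓ} (P? : Decidable P) {u v} →
            u ≢ v → P u → P v → 2 ≤ count P?
count-two {n} P? {u} {v} u≢v p q = ℕ.≤-trans
  (ℕ.+-mono-≤ (count-some (_≟ u) refl) (count-some (_≟ v) refl))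
  (length-filter-⊎ (_≟ u) (_≟ v) P? (λ { refl → p }) (λ { refl → q })
    (λ { refl → u≢v }) (allFin n))

-- Positions of the game

module Positions {n : ℕ} (G : Graph n) (k : ℕ) where
  open Graph G
  open MajorityGame G k

  ≔-updates : ∀ (c : Coloring) v {x} → (c [ v ≔ x ]) v ≡ just x
  ≔-updates c v = updateAt-updates v c

  ≔-minimal : ∀ (c : Coloring) {v u x} → u ≢ v → (c [ v ≔ x ]) u ≡ c u
  ≔-minimal c {v} {u} = updateAt-minimal u v c

  ≔-nothing⁻ : ∀ (c : Coloring) {v u x} → (c [ v ≔ x ]) u ≡ nothing → u ≢ v × c u ≡ nothing
  ≔-nothing⁻ c {v} {u} e = u≢v , trans (sym (≔-minimal c u≢v)) e
    where
    u≢v : u ≢ v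
    u≢v refl = case trans (sym (≔-updates c v)) e of λ ()

  uncolored? : ∀ (c : Coloring) v → Dec (c v ≡ nothing)
  uncolored? c v = Maybe.≡-dec _≟_ (c v) nothing

  coloredNeighbor? : ∀ (c : Coloring) v x u → Dec (v ~ u × c u ≡ just x)
  coloredNeighbor? c v x u = (v ~? u) ×-dec Maybe.≡-dec _≟_ (c u) (just x)

  -- Giving `v` the color `y` raises the count only at neighbors of `v` colored `y`, so besides `v`
  -- itself only these have to be checked.
  legal-intro : ∀ {c v y} → Majority c → c v ≡ nothing →
    2 * neighborsColored c v y ≤ deg v →
    (∀ u → v ~ u → c u ≡ just y → 2 * suc (neighborsColored c u y) ≤ deg u) →
    Legal c v y
  legal-intro {c} {v} {y} maj cv own others = cv , maj′
    where
    c′ = c [ v ≔ y ]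
    maj′ : Majority c′
    maj′ w x e with w ≟ v
    maj′ w x e | yes refl with refl ← Maybe.just-injective (trans (sym (≔-updates c v)) e) =
      ℕ.≤-trans (ℕ.*-monoʳ-≤ 2 (count-⊆ (coloredNeighbor? c′ v y) (coloredNeighbor? c v y)
        λ { (v~u , e′) → v~u , trans (sym (≔-minimal c λ { refl → ~-irr v~u })) e′ })) own
    maj′ w x e | no w≢v with cw ← trans (sym (≔-minimal c w≢v)) e | (v ~? w) ×-dec (y ≟ x)
    ... | yes (v~w , refl) =
      ℕ.≤-trans (ℕ.*-monoʳ-≤ 2 (count-insert (coloredNeighbor? c′ w y) (coloredNeighbor? c w y) v new))
                (others w v~w cw)
      where
      new : ∀ {u} → w ~ u × c′ u ≡ just y → (w ~ u × c u ≡ just y) ⊎ u ≡ v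
      new {u} (w~u , e′) with u ≟ v
      ... | yes u≡v = inj₂ u≡v
      ... | no  u≢v = inj₁ (w~u , trans (sym (≔-minimal c u≢v)) e′)
    ... | no ¬both =
      ℕ.≤-trans (ℕ.*-monoʳ-≤ 2 (count-⊆ (coloredNeighbor? c′ w x) (coloredNeighbor? c w x) old))
                (maj w x cw)
      where
      old : ∀ {u} → w ~ u × c′ u ≡ just x → w ~ u × c u ≡ just x
      old {u} (w~u , e′) with u ≟ v
      ... | yes refl = contradiction
        (~-sym w~u , Maybe.just-injective (trans (sym (≔-updates c v)) e′)) ¬both
      ... | no  u≢v = w~u , trans (sym (≔-minimal c u≢v)) e′

  legal-unused : ∀ {c v} y → Majority c → c v ≡ nothing →
    (∀ u → v ~ u → c u ≢ just y) → Legal c v y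
  legal-unused {c} {v} y maj cv unused = legal-intro maj cv
    (subst (λ m → 2 * m ≤ deg v)
      (sym (count-none (coloredNeighbor? c v y) λ { (v~u , cu) → unused _ v~u cu })) z≤n)
    (λ u v~u cu → contradiction cu (unused u v~u))

  -- Decidability of winning positions.

  majority? : ∀ c → Dec (Majority c)
  majority? c = all? λ v → all? λ x →
    Maybe.≡-dec _≟_ (c v) (just x) →-dec (_ ℕ.≤? _)

  legal? : ∀ c v x → Dec (Legal c v x)
  legal? c v x = uncolored? c v ×-dec majority? _

  complete? : ∀ c → Dec (Complete c)
  complete? c = all? λ v → ¬? (uncolored? c v)

  bobHasWon? : ∀ c → Dec (BobHasWon c)
  bobHasWon? c = any? λ v → uncolored? c v ×-dec all? λ x → ¬? (legal? c v x)

  remaining : Coloring → ℕ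
  remaining c = count (uncolored? c)

  remaining-≔ : ∀ c {v x} → c v ≡ nothing → remaining (c [ v ≔ x ]) < remaining c
  remaining-≔ c {v} cv = count-⊂ (uncolored? _) (uncolored? c) (proj₂ ∘ ≔-nothing⁻ c) cv
    λ e → case trans (sym (≔-updates c v)) e of λ ()

  bobHasWon⇒¬aliceWins : ∀ {p c} → BobHasWon c → ¬ AliceWins p c
  bobHasWon⇒¬aliceWins (v , cv , _) (done full)    = full v cv
  bobHasWon⇒¬aliceWins b            (move ¬b _ _ _ _) = ¬b b
  bobHasWon⇒¬aliceWins b            (reply ¬b _)   = ¬b b

  -- Backward induction over the game. The bound `m` on the number of uncolored vertices drops with
  -- each move and makes the recursion structural.
  unfinished? : ∀ m p c → remaining c ≤ m → ¬ Complete c → ¬ BobHasWon c → Dec (AliceWins p c)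
  aliceWins?  : ∀ m p c → remaining c ≤ m → Dec (AliceWins p c)

  aliceWins? m p c r≤m = case complete? c of λ where
    (yes full) → yes (done full)
    (no ¬full) → case bobHasWon? c of λ where
      (yes b) → no (bobHasWon⇒¬aliceWins b)
      (no ¬b) → unfinished? m p c r≤m ¬full ¬b

  unfinished? zero p c r≤0 ¬full _ = contradiction
    (λ v cv → case ℕ.≤-trans (count-some (uncolored? c) cv) r≤0 of λ ()) ¬full
  unfinished? (suc m) alice c r≤m ¬full ¬b =
    map′ (λ { (v , x , l , w) → move ¬b v x l w })
         (λ { (done full) → contradiction full ¬full ; (move _ v x l w) → v , x , l , w })
         (any? λ v → any? λ x → legalMove? v x)
    where
    legalMove? : ∀ v x → Dec (Legal c v x × AliceWins bob (c [ v ≔ x ]))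
    legalMove? v x = case legal? c v x of λ where
      (no ¬l) → no (¬l ∘ proj₁)
      (yes l) → map′ (l ,_) proj₂
        (aliceWins? m bob _ (ℕ.≤-pred (ℕ.≤-trans (remaining-≔ c (proj₁ l)) r≤m)))
  unfinished? (suc m) bob c r≤m ¬full ¬b =
    map′ (reply ¬b)
         (λ { (done full) → contradiction full ¬full ; (reply _ f) → f })
         (all? λ v → all? λ x → answer? v x)
    where
    answer? : ∀ v x → Dec (Legal c v x → AliceWins alice (c [ v ≔ x ]))
    answer? v x = case legal? c v x of λ where
      (no ¬l) → yes λ l → contradiction l ¬l
      (yes l) → map′ (λ w _ → w) (λ f → f l)
        (aliceWins? m alice _ (ℕ.≤-pred (ℕ.≤-trans (remaining-≔ c (proj₁ l)) r≤m)))

-- Finding the least winning palette size by search requires deciding each size.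
aliceHasWinningStrategy? : ∀ {n} (G : Graph n) k → Dec (AliceHasWinningStrategy G k)
aliceHasWinningStrategy? G k = aliceWins? _ alice _ ℕ.≤-refl
  where open Positions G k

-- The strategy with three colors

thirdColor : (x y : Fin 3) → ∃ λ z → z ≢ x × z ≢ y
thirdColor = toWitness
  {a? = all? λ x → all? λ y → any? λ z → ¬? (z ≟ x) ×-dec ¬? (z ≟ y)} tt

double-min : ∀ a b {d} → a + b ≤ d → 2 * a ≤ d ⊎ 2 * b ≤ d
double-min a b a+b≤d with ℕ.≤-total a b
... | inj₁ a≤b = inj₁ (ℕ.≤-trans (ℕ.+-monoʳ-≤ a (subst (_≤ b) (sym (ℕ.+-identityʳ a)) a≤b)) a+b≤d)
... | inj₂ b≤a = inj₂ (ℕ.≤-trans (ℕ.+-mono-≤ b≤a (ℕ.≤-reflexive (ℕ.+-identityʳ b))) a+b≤d)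

-- The strategy sees the tree only through this interface. Levels are counted upwards from the
-- leaves, since the argument distinguishes vertices by their distance to the bottom.
record HeightFunction {n : ℕ} (G : Graph n) : Set where
  open Graph G

  field
    height : Fin n → ℕ

  _Below_ : Fin n → Fin n → Set
  u Below v = v ~ u × height v ≡ suc (height u)

  field
    ~⇒Below       : ∀ {u v} → u ~ v → u Below v ⊎ v Below u
    parent-unique : ∀ {u v w} → u Below v → u Below w → v ≡ w
    child-exists  : ∀ {v h} → height v ≡ suc h → ∃ λ u → u Below v

module Strategy {n : ℕ} (G : Graph n) (H : HeightFunction G) where

  open Graph G
  open HeightFunction H
  open MajorityGame G 3
  open Positions G 3

  Guarded : ℕ → Set
  Guarded h = h ≡ 1 ⊎ h ≡ 3

  guarded? : Decidable Guarded
  guarded? h = (h ℕ.≟ 1) ⊎-dec (h ℕ.≟ 3)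

  ¬guarded-suc : ∀ {h} → Guarded h → ¬ Guarded (suc h)
  ¬guarded-suc (inj₁ refl) (inj₁ ())
  ¬guarded-suc (inj₁ refl) (inj₂ ())
  ¬guarded-suc (inj₂ refl) (inj₁ ())
  ¬guarded-suc (inj₂ refl) (inj₂ ())

  -- The invariant after each move of Alice. The field `low` stands for the root being colored: in
  -- the application no other vertex has height above 3.
  record Secure (c : Coloring) : Set where
    field
      majority : Majority c
      low      : ∀ v → c v ≡ nothing → height v ≤ 3
      quiet    : ∀ {v u} → c v ≡ nothing → Guarded (height v) → u Below v → c u ≡ nothing

  -- What survives a move of Bob: the colored children of an uncolored guarded vertex show at most
  -- one color. This suffices for every uncolored vertex to have a legal color.
  record Tenable (c : Coloring) : Set where
    field
      majority   : Majority c
      low        : ∀ v → c v ≡ nothing → height v ≤ 3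
      monochrome : ∀ {v} → c v ≡ nothing → Guarded (height v) →
                   ∃ λ z → ∀ {u x} → u Below v → c u ≡ just x → x ≡ z

  secure⇒tenable : ∀ {c} → Secure c → Tenable c
  secure⇒tenable s = record
    { majority   = majority
    ; low        = low
    -- The children are uncolored, so `zero` is an arbitrary choice.
    ; monochrome = λ cv g → zero , λ b cu → case trans (sym (quiet cv g b)) cu of λ ()
    } where open Secure s

  -- Before the move these children were all uncolored, so his color `x` is the only one they can
  -- show.
  tenable-after-bob : ∀ {c w x} → Secure c → Legal c w x → Tenable (c [ w ≔ x ])
  tenable-after-bob {c} {w} {x} s (_ , maj′) = record
    { majority   = maj′
    ; low        = λ v e → low v (proj₂ (≔-nothing⁻ c e))
    ; monochrome = λ e g → x , λ b e′ → onlyBob e g b e′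
    }
    where
    open Secure s
    onlyBob : ∀ {v u y} → (c [ w ≔ x ]) v ≡ nothing → Guarded (height v) → u Below v →
              (c [ w ≔ x ]) u ≡ just y → y ≡ x
    onlyBob {v} {u} e g b e′ with u ≟ w
    ... | yes refl = Maybe.just-injective (trans (sym e′) (≔-updates c w))
    ... | no u≢w = case trans (sym e′) (trans (≔-minimal c u≢w) (quiet (proj₂ (≔-nothing⁻ c e)) g b)) of λ ()

  -- If the parent is missing or uncolored, the claim is vacuous and `zero` is a dummy. Later proofs
  -- thus always have exactly one color to avoid on account of the parent.
  parentColor : ∀ (c : Coloring) v → ∃ λ z → ∀ {u x} → v Below u → c u ≡ just x → x ≡ z
  parentColor c v with any? (λ u → (u ~? v) ×-dec (height u ℕ.≟ suc (height v)))
  ... | no  none = zero , λ b _ → contradiction (_ , b) none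
  ... | yes (p , vBp) with c p in cp
  ...   | nothing = zero , λ b cu → case trans (sym (trans (cong c (parent-unique b vBp)) cp)) cu of λ ()
  ...   | just z  = z , λ b cu →
    Maybe.just-injective (trans (sym cu) (trans (cong c (parent-unique b vBp)) cp))

  colorable-monochrome-children : ∀ {c v z} → Majority c → c v ≡ nothing →
    (∀ {u x} → u Below v → c u ≡ just x → x ≡ z) → ∃ (Legal c v)
  colorable-monochrome-children {c} {v} {z} maj cv children with parentColor c v
  ... | z′ , parent with thirdColor z z′
  ...   | y , y≢z , y≢z′ = y , legal-unused y maj cv λ u v~u cu →
    Sum.[ (λ vBu → y≢z′ (parent vBu cu)) , (λ uBv → y≢z (children uBv cu)) ] (~⇒Below v~u)

  deg-leaf : ∀ {v} → height v ≡ 0 → deg v ≤ 1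
  deg-leaf {v} h≡0 = count-unique (v ~?_) λ v~u v~w → parent-unique (up v~u) (up v~w)
    where
    up : ∀ {u} → v ~ u → v Below u
    up v~u with ~⇒Below v~u
    ... | inj₁ vBu        = vBu
    ... | inj₂ (_ , h≡1+) = case trans (sym h≡0) h≡1+ of λ ()

  -- A neighbor in its own color would violate the majority condition at the leaf, whose degree is
  -- at most 1.
  leaf≢parent : ∀ {c u v x} → Majority c → height u ≡ 0 → u ~ v →
                c u ≡ just x → c v ≢ just x
  leaf≢parent {c} {u} {v} {x} maj h≡0 u~v cu cv =
    case ℕ.≤-trans (ℕ.*-monoʳ-≤ 2 (count-some (coloredNeighbor? c u x) (u~v , cv)))
                   (ℕ.≤-trans (maj u x cu) (deg-leaf h≡0)) of λ { (s≤s ()) }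

  colorable-2 : ∀ {c v} → Majority c → c v ≡ nothing → height v ≡ 2 → ∃ (Legal c v)
  colorable-2 {c} {v} maj cv h≡2 with parentColor c v
  -- Passing `z` twice asks merely for a color different from `z`.
  ... | z , parent with thirdColor z z
  ...   | y₁ , y₁≢z , _ with thirdColor y₁ z
  ...     | y₂ , y₂≢y₁ , y₂≢z =
    Sum.[ (λ few → y₁ , legal y₁≢z few) , (λ few → y₂ , legal y₂≢z few) ]
      (double-min (neighborsColored c v y₁) (neighborsColored c v y₂)
        -- The two color classes are disjoint sets of neighbors, so their sizes sum to at most
        -- `deg v`.
        (length-filter-⊎ (coloredNeighbor? c v y₁) (coloredNeighbor? c v y₂) (v ~?_)
          proj₁ proj₁
          (λ { (_ , e₁) (_ , e₂) → y₂≢y₁ (Maybe.just-injective (trans (sym e₂) e₁)) })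
          (allFin n)))
    where
    module _ {y} (y≢z : y ≢ z) where
      tolerant : ∀ u → v ~ u → c u ≡ just y → 2 * suc (neighborsColored c u y) ≤ deg u
      tolerant u v~u cu with ~⇒Below v~u
      ... | inj₁ vBu = contradiction (parent vBu cu) y≢z
      -- The child `u` has no neighbor colored `y` yet, so `v` becomes the only one, which degree 2
      -- permits.
      ... | inj₂ uBv@(_ , h≡) = subst (λ m → 2 * suc m ≤ deg u)
              (sym (count-none (coloredNeighbor? c u y) λ { (u~w , cw) → lonely u~w cw })) deg≥2
        where
        hu≡1 : height u ≡ 1
        hu≡1 = ℕ.suc-injective (trans (sym h≡) h≡2)
        -- The parent of `u` is the uncolored `v`, and the children of `u` are leaves.
        lonely : ∀ {w} → u ~ w → c w ≢ just y
        lonely u~w cw with ~⇒Below u~w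
        ... | inj₁ uBw = case trans (sym cv) (trans (cong c (parent-unique uBv uBw)) cw) of λ ()
        ... | inj₂ (_ , hu≡) =
          leaf≢parent maj (ℕ.suc-injective (trans (sym hu≡) hu≡1)) (~-sym u~w) cw cu
        deg≥2 : 2 ≤ deg u
        deg≥2 with child-exists hu≡1
        ... | w , (u~w , hu≡) = count-two (u ~?_)
          -- The neighbors `v` and `w` lie above and below `u`, hence differ.
          (λ { refl → ℕ.m≢1+n+m (height v) {1} (trans h≡ (cong suc hu≡)) }) (~-sym v~u) u~w

      legal : 2 * neighborsColored c v y ≤ deg v → Legal c v y
      legal few = legal-intro maj cv few tolerant

  colorable : ∀ {c} → Tenable c → ∀ v → c v ≡ nothing → ∃ (Legal c v)
  colorable {c} t v cv = byHeight (height v) refl (low v cv)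
    where
    open Tenable t
    byHeight : ∀ h → height v ≡ h → h ≤ 3 → ∃ (Legal c v)
    -- Without children the condition on them is vacuous, for any `z`.
    byHeight 0 e _ = colorable-monochrome-children {z = zero} majority cv
      λ { (_ , e′) → case trans (sym e) e′ of λ () }
    byHeight 1 e _ = colorable-monochrome-children majority cv (proj₂ (monochrome cv (inj₁ e)))
    byHeight 2 e _ = colorable-2 majority cv e
    byHeight 3 e _ = colorable-monochrome-children majority cv (proj₂ (monochrome cv (inj₂ e)))
    byHeight (suc (suc (suc (suc _)))) _ (s≤s (s≤s (s≤s ())))

  ¬bobHasWon : ∀ {c} → Tenable c → ¬ BobHasWon c
  ¬bobHasWon t (v , cv , stuck) = let y , l = colorable t v cv in stuck y l

  -- The move itself could break the invariant by coloring a child of another uncolored guarded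
  -- vertex; the clause `u ≢ v` excludes this.
  secure-after-alice : ∀ {c v y} → Tenable c → Legal c v y →
    (∀ {w u} → w ≢ v → c w ≡ nothing → Guarded (height w) → u Below w → u ≢ v × c u ≡ nothing) →
    Secure (c [ v ≔ y ])
  secure-after-alice {c} t (_ , maj′) quiet′ = record
    { majority = maj′
    ; low      = λ w e → low w (proj₂ (≔-nothing⁻ c e))
    ; quiet    = λ e g b →
        let w≢v , cw = ≔-nothing⁻ c e
            u≢v , cu = quiet′ w≢v cw g b
        in trans (≔-minimal c u≢v) cu
    } where open Tenable t

  answer : ∀ {c w x} → Secure c → Legal c w x → let c′ = c [ w ≔ x ] in
    Complete c′ ⊎ ∃₂ λ v y → Legal c′ v y × Secure (c′ [ v ≔ y ])
  answer {c} {w} {x} s l = go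
    where
    c′ = c [ w ≔ x ]
    t  = tenable-after-bob s l

    notBob⇒quiet : ∀ {v u} → c′ v ≡ nothing → Guarded (height v) → u Below v →
                   u ≢ w → c′ u ≡ nothing
    notBob⇒quiet e g b u≢w =
      trans (≔-minimal c u≢w) (Secure.quiet s (proj₂ (≔-nothing⁻ c e)) g b)

    -- Heights 1 and 3 are not consecutive, so coloring one guarded vertex never colors a child of
    -- another.
    guarded⇒≢child : ∀ {v u p} → Guarded (height p) → Guarded (height v) → u Below v → u ≢ p
    guarded⇒≢child gp gv (_ , h≡) refl = ¬guarded-suc gp (subst Guarded h≡ gv)

    play : ∀ v → c′ v ≡ nothing →
      (∀ {p u} → p ≢ v → c′ p ≡ nothing → Guarded (height p) → u Below p → u ≢ v × c′ u ≡ nothing) →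
      ∃₂ λ v y → Legal c′ v y × Secure (c′ [ v ≔ y ])
    play v cv quiet′ = let y , ly = colorable t v cv in
      v , y , ly , secure-after-alice t ly quiet′

    go : Complete c′ ⊎ ∃₂ λ v y → Legal c′ v y × Secure (c′ [ v ≔ y ])
    go with any? (λ v → uncolored? c′ v ×-dec guarded? (height v) ×-dec
                        (v ~? w) ×-dec (height v ℕ.≟ suc (height w)))
    ... | yes (v , cv , gv , wBv) = inj₂ (play v cv λ p≢v cp gp uBp →
            guarded⇒≢child gv gp uBp ,
            -- If `u` were Bob's vertex, `p` would be its unique parent `v`, the vertex being
            -- colored.
            notBob⇒quiet cp gp uBp λ { refl → p≢v (parent-unique uBp wBv) })
    ... | no noThreat with any? (λ v → uncolored? c′ v ×-dec guarded? (height v))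
    ...   | yes (v , cv , gv) = inj₂ (play v cv λ p≢v cp gp uBp →
              guarded⇒≢child gv gp uBp ,
              notBob⇒quiet cp gp uBp λ { refl → noThreat (_ , cp , gp , uBp) })
    ...   | no noGuarded with any? (uncolored? c′)
    -- With no uncolored guarded vertex left, the invariant is vacuous.
    ...     | yes (v , cv) = inj₂ (play v cv λ _ cp gp _ → contradiction (_ , cp , gp) noGuarded)
    ...     | no full      = inj₁ λ v cv → full (v , cv)

  secure⇒aliceWins : ∀ m {c} → remaining c ≤ m → Secure c → AliceWins bob c
  secure⇒aliceWins m {c} r≤m s = reply (¬bobHasWon (secure⇒tenable s)) (respond m r≤m)
    where
    respond : ∀ m → remaining c ≤ m → ∀ w x → Legal c w x → AliceWins alice (c [ w ≔ x ])
    respond zero r≤0 w x (cw , _) = case ℕ.≤-trans (count-some (uncolored? c) cw) r≤0 of λ ()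
    respond (suc m) r≤m w x l with answer s l
    ... | inj₁ full = done full
    ... | inj₂ (v , y , l′ , s′) = move (¬bobHasWon (tenable-after-bob s l)) v y l′
      -- A round colors two vertices while `m` drops by one; `ℕ.<⇒≤` discards the slack.
      (secure⇒aliceWins m (ℕ.≤-trans (ℕ.<⇒≤ (remaining-≔ _ (proj₁ l′)))
        (ℕ.≤-pred (ℕ.≤-trans (remaining-≔ c (proj₁ l)) r≤m))) s′)

  -- By `topmost`, the first vertex `r` is nobody's child, so coloring it leaves all children
  -- uncolored.
  aliceWins : ∀ r → (∀ v → v ≢ r → height v ≤ 3) → (∀ v → ¬ r Below v) →
              AliceHasWinningStrategy G 3
  aliceWins r low topmost = move (λ { (v , _ , stuck) → stuck zero (legal v) }) r zero (legal r)
    (secure⇒aliceWins _ ℕ.≤-refl (record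
      { majority = proj₂ (legal r)
      ; low      = λ v e → low v (proj₁ (≔-nothing⁻ blank e))
      ; quiet    = λ {v} _ _ b → ≔-minimal blank λ { refl → topmost v b }
      }))
    where
    legal : ∀ v → Legal blank v zero
    legal v = legal-unused zero (λ _ _ ()) refl (λ _ _ ())

-- Depths in rooted trees

module Depth {n : ℕ} (T : RootedTree n) where
  open RootedTree T
  open Graph graph

  snoc : ∀ {u v w ℓ} → Walk u v ℓ → v ~ w → Walk u w (suc ℓ)
  snoc stop       e = step e stop
  snoc (step f p) e = step f (snoc p e)

  vertices-snoc : ∀ {u v w ℓ} (p : Walk u v ℓ) (e : v ~ w) → vertices (snoc p e) ≡ vertices p ∷ʳ w
  vertices-snoc stop       e = refl
  vertices-snoc (step f p) e = cong (_ ∷_) (vertices-snoc p e)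

  unsnoc : ∀ {u w ℓ} → Walk u w (suc ℓ) → ∃ λ v → Walk u v ℓ × v ~ w
  unsnoc (step e stop)         = _ , stop , e
  unsnoc (step e p@(step _ _)) = let v , q , f = unsnoc p in v , step e q , f

  -- Walks of a fixed length can be searched, so a distance is found as the least length admitting
  -- one.
  walk? : ∀ ℓ u v → Dec (Walk u v ℓ)
  walk? zero    u v = map′ (λ { refl → stop }) (λ { stop → refl }) (u ≟ v)
  walk? (suc ℓ) u w = map′ (λ { (_ , e , p) → step e p }) (λ { (step e p) → _ , e , p })
    (any? λ v → (u ~? v) ×-dec walk? ℓ v w)

  distance : ∀ v → ∃ (HasDepth v)
  distance v with connected root v
  ... | ℓ , p with least (λ ℓ → walk? ℓ root v) ℓ p
  ...   | d , q , min , _ = d , q , min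

  depth : Fin n → ℕ
  depth v = proj₁ (distance v)

  depth-walk : ∀ v → Walk root v (depth v)
  depth-walk v = proj₁ (proj₂ (distance v))

  depth-min : ∀ {v ℓ} → Walk root v ℓ → depth v ≤ ℓ
  depth-min {v} = proj₂ (proj₂ (distance v)) _

  hasDepth⇒≡ : ∀ {v d} → HasDepth v d → depth v ≡ d
  hasDepth⇒≡ {v} (p , min) = ℕ.≤-antisym (depth-min p) (min _ (depth-walk v))

  depth≡0⇒root : ∀ {v} → depth v ≡ 0 → v ≡ root
  depth≡0⇒root {v} e with stop ← subst (Walk root v) e (depth-walk v) = refl

  ~⇒depth≤ : ∀ {u v} → u ~ v → depth v ≤ suc (depth u)
  ~⇒depth≤ {u} e = depth-min (snoc (depth-walk u) e)

  -- The vertex before the last on a shortest walk; minimality of depths gives both inequalities.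
  parent : ∀ {v m} → depth v ≡ suc m → ∃ λ u → u ~ v × depth u ≡ m
  parent {v} {m} e with u , p , u~v ← unsnoc (subst (Walk root v) e (depth-walk v)) =
    u , u~v , ℕ.≤-antisym (depth-min p) (ℕ.≤-pred (subst (_≤ suc (depth u)) e (~⇒depth≤ u~v)))

  depth-<⇒≢ : ∀ {x y m} → depth x ≡ suc m → depth y ≤ m → x ≢ y
  depth-<⇒≢ {m = m} ex y≤m refl = ℕ.<-irrefl refl (subst (_≤ m) ex y≤m)

  -- Climb from both vertices to their parents until these coincide. The depth bound ensures that
  -- the ends attached afterwards, being deeper, do not repeat a vertex.
  lowPath : ∀ m {u w} → depth u ≡ m → depth w ≡ m → u ≢ w →
    ∃ λ ℓ → Σ (Walk u w ℓ) λ p → Unique (vertices p) × All (λ x → depth x ≤ m) (vertices p) × 2 ≤ ℓ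
  lowPath zero    eu ew u≢w = contradiction (trans (depth≡0⇒root eu) (sym (depth≡0⇒root ew))) u≢w
  lowPath (suc m) {u} {w} eu ew u≢w
    with pu , pu~u , epu ← parent eu | pw , pw~w , epw ← parent ew
    with pu ≟ pw
  ... | yes refl = 2 , step (~-sym pu~u) (step pw~w stop) ,
        ((depth-<⇒≢ eu (ℕ.≤-reflexive epu) ∷ u≢w ∷ []) ∷ (depth-<⇒≢ ew (ℕ.≤-reflexive epu) ∘ sym ∷ []) ∷ [] ∷ []) ,
        (ℕ.≤-reflexive eu ∷ ℕ.m≤n⇒m≤1+n (ℕ.≤-reflexive epu) ∷ ℕ.≤-reflexive ew ∷ []) ,
        s≤s (s≤s z≤n)
  ... | no pu≢pw with ℓ , p , uniq , low , _ ← lowPath m epu epw pu≢pw =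
        suc (suc ℓ) , step (~-sym pu~u) (snoc p pw~w) ,
        subst (λ vs → Unique (u ∷ vs)) (sym (vertices-snoc p pw~w))
          (All.∷ʳ⁺ (All.map (depth-<⇒≢ eu) low) u≢w ∷
           AllPairs.++⁺ uniq ([] ∷ []) (All.map (λ x≤m → (depth-<⇒≢ ew x≤m ∘ sym) ∷ []) low)) ,
        subst (λ vs → All _ (u ∷ vs)) (sym (vertices-snoc p pw~w))
          (ℕ.≤-reflexive eu ∷ All.∷ʳ⁺ (All.map ℕ.m≤n⇒m≤1+n low) (ℕ.≤-reflexive ew)) ,
        s≤s (s≤s z≤n)

  -- An edge within a level would close the path of `lowPath` to a cycle.
  ~⇒depth≢ : ∀ {u v} → u ~ v → depth u ≢ depth v
  ~⇒depth≢ u~v e with _ , p , uniq , _ , long ← lowPath _ e refl (λ { refl → ~-irr u~v }) =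
    acyclic (record { walk = p ; isPath = uniq ; long = long ; closing = ~-sym u~v })

  ~⇒depth-suc : ∀ {u v} → u ~ v → depth u ≡ suc (depth v) ⊎ depth v ≡ suc (depth u)
  ~⇒depth-suc {u} {v} u~v with ℕ.<-cmp (depth u) (depth v)
  ... | tri< u<v _ _ = inj₂ (ℕ.≤-antisym (~⇒depth≤ u~v) u<v)
  ... | tri≈ _ e _   = contradiction e (~⇒depth≢ u~v)
  ... | tri> _ _ v<u = inj₁ (ℕ.≤-antisym (~⇒depth≤ (~-sym u~v)) v<u)

  -- Two parents are joined by a path no deeper than themselves; it avoids `u` and so closes to a
  -- cycle through `u`.
  parent-unique : ∀ {u v w} → v ~ u → w ~ u → depth u ≡ suc (depth v) → depth u ≡ suc (depth w) → v ≡ w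
  parent-unique {u} {v} {w} v~u w~u ev ew with v ≟ w
  ... | yes v≡w = v≡w
  ... | no  v≢w with _ , p , uniq , low , long ← lowPath _ refl (ℕ.suc-injective (trans (sym ew) ev)) v≢w =
    ⊥-elim (acyclic (record
      { walk    = step (~-sym v~u) p
      ; isPath  = All.map (depth-<⇒≢ ev) low ∷ uniq
      ; long    = ℕ.m≤n⇒m≤1+n long
      ; closing = w~u
      }))

  module _ {k : ℕ} (leaves : AllLeavesAtDepth k) where

    -- A vertex without a deeper neighbor is a leaf; here the hypothesis on leaves enters.
    child-or-bottom : ∀ v → (∃ λ u → v ~ u × depth u ≡ suc (depth v)) ⊎ depth v ≡ k
    child-or-bottom v with any? (λ u → (v ~? u) ×-dec (depth u ℕ.≟ suc (depth v)))
    ... | yes child = inj₁ child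
    ... | no  none  = inj₂ (hasDepth⇒≡ (leaves v λ { u (v~u , d , dv , du) →
      none (u , v~u , trans (hasDepth⇒≡ du) (cong suc (sym (hasDepth⇒≡ dv)))) }))

    -- A descent through children only increases the depth, must end because depths are bounded, and
    -- can end only at depth `k`.
    depth≤k : ∀ v → depth v ≤ k
    depth≤k v = descend M v (ℕ.m≤n+m M (depth v))
      where
      M = proj₁ (bounded depth)
      -- `f` bounds the levels left before `M`; at 0 a child would lie deeper than `M`.
      descend : ∀ f v → M ≤ depth v + f → depth v ≤ k
      descend f v M≤ with child-or-bottom v
      descend f       v M≤ | inj₂ e = ℕ.≤-reflexive e
      descend zero    v M≤ | inj₁ (u , _ , eu) = contradiction
        (ℕ.≤-trans (subst (_≤ M) eu (proj₂ (bounded depth) u)) (subst (M ≤_) (ℕ.+-identityʳ _) M≤))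
        (ℕ.<-irrefl refl)
      descend (suc f) v M≤ | inj₁ (u , _ , eu) = ℕ.≤-trans (ℕ.n≤1+n _)
        (subst (_≤ k) eu (descend f u
          (subst (M ≤_) (trans (ℕ.+-suc _ f) (cong (_+ f) (sym eu))) M≤)))

    height : Fin n → ℕ
    height v = k ∸ depth v

    -- The bound `depth≤k` keeps the truncated subtraction exact.
    depth-suc⇒height-suc : ∀ {u v} → depth u ≡ suc (depth v) → height v ≡ suc (height u)
    depth-suc⇒height-suc {u} {v} e = trans
      (ℕ.+-∸-assoc 1 (subst (_≤ k) e (depth≤k u))) (cong (λ d → suc (k ∸ d)) (sym e))

    height-suc⇒depth-suc : ∀ {u v} → v ~ u → height v ≡ suc (height u) → depth u ≡ suc (depth v)
    height-suc⇒depth-suc {u} {v} v~u e with ~⇒depth-suc v~u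
    ... | inj₂ eu = eu
    ... | inj₁ ev = contradiction (trans e (cong suc (depth-suc⇒height-suc ev))) (ℕ.m≢1+n+m (height v) {1})

    heightFunction : HeightFunction graph
    heightFunction = record
      { height        = height
      ; ~⇒Below       = λ u~v → Sum.map
          (λ e → ~-sym u~v , depth-suc⇒height-suc e)
          (λ e → u~v , depth-suc⇒height-suc e) (~⇒depth-suc u~v)
      ; parent-unique = λ { (v~u , ev) (w~u , ew) → parent-unique v~u w~u
          (height-suc⇒depth-suc v~u ev) (height-suc⇒depth-suc w~u ew) }
      ; child-exists  = λ {v} e → case child-or-bottom v of λ where
          (inj₁ (u , v~u , eu)) → u , v~u , depth-suc⇒height-suc eu
          (inj₂ ek) → case trans (sym e) (trans (cong (k ∸_) ek) (ℕ.n∸n≡0 k)) of λ ()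
      }

    aliceWins₃ : k ≤ 4 → AliceHasWinningStrategy graph 3
    aliceWins₃ k≤4 = Strategy.aliceWins graph heightFunction root low topmost
      where
      low : ∀ v → v ≢ root → height v ≤ 3
      low v v≢root with depth v in e
      ... | zero  = contradiction (depth≡0⇒root e) v≢root
      -- Depth at least 1 leaves height at most `k ∸ 1`, which is at most 3.
      ... | suc d = ℕ.≤-trans (ℕ.∸-monoʳ-≤ k (s≤s z≤n)) (ℕ.∸-monoˡ-≤ 1 k≤4)

      topmost : ∀ v → ¬ (v ~ root × height v ≡ suc (height root))
      topmost v (v~root , e) =
        case subst (_≤ 0) (height-suc⇒depth-suc v~root e) (depth-min stop) of λ ()

theorem8 : ∀ (k : ℕ) → 1 ≤ k → k ≤ 4 →
    ∀ (n : ℕ) (T : RootedTree n) →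
    Graph.HasEdge (RootedTree.graph T) →
    RootedTree.AllLeavesAtDepth T k →
    ∃ λ m → IsMajorityGameChromaticNumber (RootedTree.graph T) m × m ≤ 3
theorem8 k _ k≤4 n T _ leaves =
  -- The win with three colors bounds the search, which yields `m ≤ 3` along with minimality.
  let m , wins , min , m≤3 = least (aliceHasWinningStrategy? (RootedTree.graph T)) 3
                               (Depth.aliceWins₃ T leaves k≤4)
  in m , (wins , min) , m≤3
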